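{- Let $M\subseteq\mathbb{Z}$ with $1\in M$, let $d$ be a pseudometric on $M$, and let $\preceq_d$ be the corresponding induced preorder on $M$. Then $$M/\!\sim_d\ \sqsubseteq\ M/\!\sim_{\preceq_d},$$ i.e. the partition $M/\!\sim_d$ is a refinement of the partition $M/\!\sim_{\preceq_d}$.
   Context: A pseudometric on $M$ is a function $d:M\times M\to\mathbb{R}$ with $d(x,x)=0$, $d(x,y)=d(y,x)$ and $d(x,z)\le d(x,y)+d(y,z)$ for all $x,y,z\in M$. The induced preorder is $x\preceq_d y\iff d(1,x)\le d(1,y)$. The equivalence relations are $x\sim_d y\iff d(x,y)=0$ and $x\sim_{\preceq_d}y\iff(x\preceq_d y\text{ and }y\preceq_d x)$. For equivalence relations $\sim_1,\sim_2$ on $M$, $M/\!\sim_1\ \sqsubseteq\ M/\!\sim_2$ means $[x]_{\sim_1}\subseteq[x]_{\sim_2}$ for all $x\in M$. -}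

module Defs where

open import Data.Integer.Base using (ℤ; 1ℤ)
open import Data.Irrelevant using ([_])
open import Data.Nat.Base as ℕ using (ℕ)
import Data.Nat.Properties as ℕ
open import Data.Product.Base using (∃-syntax; _×_; _,_)
open import Data.Rational.Base using (ℚ; 0ℚ; ½; _+_; _-_; _*_; -_; ∣_∣; _<_; positive)
import Data.Rational.Base as ℚ
import Data.Rational.Properties as ℚ
open import Data.Rational.Solver using (module +-*-Solver)
open import Data.Refinement using (Refinement; _,_)
open import Data.Sum.Base using (inj₁; inj₂)
open import Level using (Level; 0ℓ; _⊔_; suc)
open import Relation.Binary.Core using (Rel)
open import Relation.Binary.Structures using (IsEquivalence)
open import Relation.Binary.Bundles using (Poset; Preorder; Setoid)
import Relation.Binary.Reasoning.PartialOrder as ≤-Reasoning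
import Relation.Binary.Properties.Preorder as PreorderProperties
open import Relation.Binary.PropositionalEquality using (_≡_; refl; sym; trans; cong; subst)
import Relation.Binary.PropositionalEquality.Properties as ≡
open import Relation.Unary using (Pred; _∈_; _⊆_)

private
  variable
    a ℓ ℓ₁ ℓ₂ : Level

------------------------------------------------------------------------
-- Real numbers
--
-- ℝ is the type of Cauchy sequences of rationals. The quotient by null
-- sequences is expressed by the setoid equality _≃_, so equations between
-- reals are stated with _≃_ rather than _≡_.

Eventually : Pred ℕ 0ℓ → Set
Eventually P = ∃[ N ] (∀ n → N ℕ.≤ n → P n)

record ℝ : Set where
  constructor mkℝ
  field
    seq    : ℕ → ℚ
    cauchy : ∀ ε → 0ℚ < ε →
             ∃[ N ] (∀ m n → N ℕ.≤ m → N ℕ.≤ n → ∣ seq m - seq n ∣ < ε)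

open ℝ public

infix 4 _≃_ _≤_
infixl 6 _⊕_

_≃_ : Rel ℝ 0ℓ
x ≃ y = ∀ ε → 0ℚ < ε → Eventually (λ n → ∣ seq x n - seq y n ∣ < ε)

-- The bound must hold for every ε: a termwise eventual comparison of the
-- representing sequences would not be invariant under _≃_.
_≤_ : Rel ℝ 0ℓ
x ≤ y = ∀ ε → 0ℚ < ε → Eventually (λ n → seq x n - seq y n < ε)

0ℝ : ℝ
0ℝ = mkℝ (λ _ → 0ℚ) (λ _ 0<ε → 0 , λ _ _ _ _ → 0<ε)

private
  half : ℚ → ℚ
  half ε = ½ * ε

  half-pos : ∀ {ε} → 0ℚ < ε → 0ℚ < half ε
  half-pos {ε} 0<ε =
    ℚ.positive⁻¹ (½ * ε) {{ℚ.pos*pos⇒pos ½ ε {{positive 0<ε}}}}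

  half+half : ∀ ε → half ε + half ε ≡ ε
  half+half ε = trans (sym (ℚ.*-distribʳ-+ ε ½ ½)) (ℚ.*-identityˡ ε)

  <-halves : ∀ {p q} ε → p < half ε → q < half ε → p + q < ε
  <-halves ε p< q< = subst (_ <_) (half+half ε) (ℚ.+-mono-< p< q<)

  zip-Eventually : ∀ {P Q R : Pred ℕ 0ℓ} → (∀ {n} → P n → Q n → R n) →
                   Eventually P → Eventually Q → Eventually R
  zip-Eventually f (M , p) (N , q) = M ℕ.⊔ N , λ n le →
    f (p n (ℕ.m⊔n≤o⇒m≤o M N le)) (q n (ℕ.m⊔n≤o⇒n≤o M N le))

  telescope : ∀ p q r → (p - q) + (q - r) ≡ p - r
  telescope = solve 3 (λ p q r → (p :- q) :+ (q :- r) := p :- r) refl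
    where open +-*-Solver

  interchange : ∀ p q r s → (p - r) + (q - s) ≡ (p + q) - (r + s)
  interchange = solve 4 (λ p q r s → (p :- r) :+ (q :- s) := (p :+ q) :- (r :+ s)) refl
    where open +-*-Solver

  flip-minus : ∀ p q → - (p - q) ≡ q - p
  flip-minus = solve 2 (λ p q → :- (p :- q) := q :- p) refl
    where open +-*-Solver

  p≤∣p∣ : ∀ p → p ℚ.≤ ∣ p ∣
  p≤∣p∣ p with ℚ.≤-total 0ℚ p
  ... | inj₁ 0≤p = ℚ.≤-reflexive (sym (ℚ.0≤p⇒∣p∣≡p 0≤p))
  ... | inj₂ p≤0 = ℚ.≤-trans p≤0 (ℚ.0≤∣p∣ p)

_⊕_ : ℝ → ℝ → ℝ
x ⊕ y = mkℝ (λ n → seq x n + seq y n) λ ε 0<ε →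
  let M , p = cauchy x (half ε) (half-pos 0<ε)
      N , q = cauchy y (half ε) (half-pos 0<ε)
  in M ℕ.⊔ N , λ m n m≥ n≥ →
    subst (λ r → ∣ r ∣ < ε) (interchange (seq x m) (seq y m) (seq x n) (seq y n))
      (ℚ.≤-<-trans (ℚ.∣p+q∣≤∣p∣+∣q∣ (seq x m - seq x n) (seq y m - seq y n))
        (<-halves ε
          (p m n (ℕ.m⊔n≤o⇒m≤o M N m≥) (ℕ.m⊔n≤o⇒m≤o M N n≥))
          (q m n (ℕ.m⊔n≤o⇒n≤o M N m≥) (ℕ.m⊔n≤o⇒n≤o M N n≥))))

≃⇒≤ : ∀ {x y} → x ≃ y → x ≤ y
≃⇒≤ {x} {y} x≃y ε 0<ε with x≃y ε 0<ε
... | N , p = N , λ n le → ℚ.≤-<-trans (p≤∣p∣ (seq x n - seq y n)) (p n le)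

≤-antisym : ∀ {x y} → x ≤ y → y ≤ x → x ≃ y
≤-antisym {x} {y} x≤y y≤x ε 0<ε =
  zip-Eventually (λ {n} → bound (seq x n) (seq y n)) (x≤y ε 0<ε) (y≤x ε 0<ε)
  where
  bound : ∀ p q → p - q < ε → q - p < ε → ∣ p - q ∣ < ε
  bound p q p-q<ε q-p<ε with ℚ.∣p∣≡p∨∣p∣≡-p (p - q)
  ... | inj₁ eq = subst (_< ε) (sym eq) p-q<ε
  ... | inj₂ eq = subst (_< ε) (sym (trans eq (flip-minus p q))) q-p<ε

≤-refl : ∀ {x} → x ≤ x
≤-refl {x} ε 0<ε = 0 , λ n _ → subst (_< ε) (sym (ℚ.+-inverseʳ (seq x n))) 0<ε

≤-trans : ∀ {x y z} → x ≤ y → y ≤ z → x ≤ z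
≤-trans {x} {y} {z} x≤y y≤z ε 0<ε =
  zip-Eventually
    (λ {n} p q → subst (_< ε) (telescope (seq x n) (seq y n) (seq z n)) (<-halves ε p q))
    (x≤y (half ε) (half-pos 0<ε)) (y≤z (half ε) (half-pos 0<ε))

≃-refl : ∀ {x} → x ≃ x
≃-refl {x} = ≤-antisym {x} {x} (≤-refl {x}) (≤-refl {x})

≃-sym : ∀ {x y} → x ≃ y → y ≃ x
≃-sym {x} {y} x≃y ε 0<ε with x≃y ε 0<ε
... | N , p = N , λ n le → subst (_< ε) (∣-∣-swap (seq x n) (seq y n)) (p n le)
  where
  ∣-∣-swap : ∀ p q → ∣ p - q ∣ ≡ ∣ q - p ∣
  ∣-∣-swap p q = trans (sym (ℚ.∣-p∣≡∣p∣ (p - q))) (cong ∣_∣ (flip-minus p q))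

≃-trans : ∀ {x y z} → x ≃ y → y ≃ z → x ≃ z
≃-trans {x} {y} {z} x≃y y≃z = ≤-antisym {x} {z}
  (≤-trans {x} {y} {z} (≃⇒≤ {x} {y} x≃y) (≃⇒≤ {y} {z} y≃z))
  (≤-trans {z} {y} {x} (≃⇒≤ {z} {y} (≃-sym {y} {z} y≃z)) (≃⇒≤ {y} {x} (≃-sym {x} {y} x≃y)))

≤-poset : Poset 0ℓ 0ℓ 0ℓ
≤-poset = record
  { Carrier        = ℝ
  ; _≈_            = _≃_
  ; _≤_            = _≤_
  ; isPartialOrder = record
    { isPreorder = record
      { isEquivalence = record
        { refl  = λ {x} → ≃-refl {x}
        ; sym   = λ {x} {y} → ≃-sym {x} {y}
        ; trans = λ {x} {y} {z} → ≃-trans {x} {y} {z}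
        }
      ; reflexive = λ {x} {y} → ≃⇒≤ {x} {y}
      ; trans     = λ {x} {y} {z} → ≤-trans {x} {y} {z}
      }
    ; antisym = λ {x} {y} → ≤-antisym {x} {y}
    }
  }

⊕-mono-≤ : ∀ {x y u v} → x ≤ y → u ≤ v → x ⊕ u ≤ y ⊕ v
⊕-mono-≤ {x} {y} {u} {v} x≤y u≤v ε 0<ε =
  zip-Eventually
    (λ {n} p q → subst (_< ε) (interchange (seq x n) (seq u n) (seq y n) (seq v n)) (<-halves ε p q))
    (x≤y (half ε) (half-pos 0<ε)) (u≤v (half ε) (half-pos 0<ε))

⊕-identityʳ : ∀ x → x ⊕ 0ℝ ≃ x
⊕-identityʳ x ε 0<ε = 0 , λ n _ →
  subst (_< ε) (sym (cong ∣_∣ (lemma (seq x n)))) 0<ε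
  where
  lemma : ∀ p → (p + 0ℚ) - p ≡ 0ℚ
  lemma p = trans (cong (_- p) (ℚ.+-identityʳ p)) (ℚ.+-inverseʳ p)

------------------------------------------------------------------------
-- Equivalence relations, their classes, and refinement of partitions

-- A partition A/∼ is represented by the equivalence relation ∼.
record Partition (A : Set a) ℓ : Set (a ⊔ suc ℓ) where
  field
    _∼_           : Rel A ℓ
    isEquivalence : IsEquivalence _∼_

  class : A → Pred A ℓ
  class x = λ y → x ∼ y

infix 4 _⊑_

_⊑_ : {A : Set a} → Partition A ℓ₁ → Partition A ℓ₂ → Set (a ⊔ ℓ₁ ⊔ ℓ₂)
P ⊑ Q = ∀ x → Partition.class P x ⊆ Partition.class Q x

------------------------------------------------------------------------
-- Pseudometrics on subsets of ℤ

-- The membership proof in a refinement type is irrelevant, so elements of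
-- ⟪ M ⟫ are equal as soon as the underlying integers are.
⟪_⟫ : Pred ℤ ℓ → Set ℓ
⟪ M ⟫ = Refinement ℤ M

record IsPseudometric {A : Set a} (d : A → A → ℝ) : Set a where
  field
    d-zero     : ∀ x → d x x ≃ 0ℝ
    d-sym      : ∀ x y → d x y ≃ d y x
    d-triangle : ∀ x y z → d x z ≤ d x y ⊕ d y z

-- x ∼ y ⇔ d(x,y) = 0
zeroDistance : {A : Set a} {d : A → A → ℝ} → IsPseudometric d → Partition A 0ℓ
zeroDistance {A = A} {d = d} isPseudometric = record
  { _∼_           = _∼_
  ; isEquivalence = record
    { refl  = λ {x} → d-zero x
    ; sym   = λ {x} {y} → ∼-sym {x} {y}
    ; trans = λ {x} {y} {z} → ∼-trans {x} {y} {z}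
    }
  }
  where
  open IsPseudometric isPseudometric

  _∼_ : Rel A 0ℓ
  x ∼ y = d x y ≃ 0ℝ

  ∼-sym : ∀ {x y} → x ∼ y → y ∼ x
  ∼-sym {x} {y} x∼y = ≃-trans {d y x} {d x y} {0ℝ} (d-sym y x) x∼y

  ∼-trans : ∀ {x y z} → x ∼ y → y ∼ z → x ∼ z
  ∼-trans {x} {y} {z} x∼y y∼z = ≤-antisym {d x z} {0ℝ} xz≤0 0≤xz
    where
    open ≤-Reasoning ≤-poset

    xz≤0 : d x z ≤ 0ℝ
    xz≤0 = begin
      d x z         ≤⟨ d-triangle x y z ⟩
      d x y ⊕ d y z ≤⟨ ⊕-mono-≤ {d x y} {0ℝ} {d y z} {0ℝ}
                         (≃⇒≤ {d x y} {0ℝ} x∼y) (≃⇒≤ {d y z} {0ℝ} y∼z) ⟩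
      0ℝ ⊕ 0ℝ       ≈⟨ ⊕-identityʳ 0ℝ ⟩
      0ℝ            ∎

    zx≤0 : d z x ≤ 0ℝ
    zx≤0 = begin
      d z x         ≈⟨ d-sym z x ⟩
      d x z         ≤⟨ xz≤0 ⟩
      0ℝ            ∎

    0≤xz : 0ℝ ≤ d x z
    0≤xz = begin
      0ℝ            ≈⟨ d-zero x ⟨
      d x x         ≤⟨ d-triangle x z x ⟩
      d x z ⊕ d z x ≤⟨ ⊕-mono-≤ {d x z} {d x z} {d z x} {0ℝ} (≤-refl {d x z}) zx≤0 ⟩
      d x z ⊕ 0ℝ    ≈⟨ ⊕-identityʳ (d x z) ⟩
      d x z         ∎

-- x ⪯ y ⇔ d(1,x) ≤ d(1,y)
inducedPreorder : {M : Pred ℤ ℓ} → 1ℤ ∈ M → (⟪ M ⟫ → ⟪ M ⟫ → ℝ) → Preorder ℓ ℓ 0ℓ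
inducedPreorder {M = M} 1∈M d = record
  { Carrier    = ⟪ M ⟫
  ; _≈_        = _≡_
  ; _≲_        = λ x y → d one x ≤ d one y
  ; isPreorder = record
    { isEquivalence = ≡.isEquivalence
    ; reflexive     = λ { {x} refl → ≤-refl {d one x} }
    ; trans         = λ {x} {y} {z} → ≤-trans {d one x} {d one y} {d one z}
    }
  }
  where
  one : ⟪ M ⟫
  one = 1ℤ , [ 1∈M ]

symmetricPart : (P : Preorder a ℓ₁ ℓ₂) → Partition (Preorder.Carrier P) ℓ₂
symmetricPart P = record
  { _∼_           = λ x y → x ≲ y × y ≲ x
  ; isEquivalence = Setoid.isEquivalence (PreorderProperties.InducedEquivalence P)
  }
  where open Preorder P using (_≲_)

{-# OPTIONS --safe #-}
module Submission where

open import Data.Integer.Base using (ℤ; 1ℤ)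
open import Data.Irrelevant using ([_])
open import Data.Product.Base using (_,_)
open import Data.Refinement using (_,_)
open import Level using (Level)
import Relation.Binary.Reasoning.PartialOrder as ≤-Reasoning
open import Relation.Binary.Structures using (IsEquivalence)
open import Relation.Unary using (Pred; _∈_)
open import Defs

-- Points at distance zero from each other are equally far from every base point `z`: going from `z`
-- to `y` through `x` costs at most `d z x ⊕ d x y`, and the second term vanishes. Using this both
-- ways with `z` equal to 1 gives the two halves of the symmetric part of the induced preorder.

zeroDistance⇒≤ : ∀ {a} {A : Set a} {d : A → A → ℝ} → IsPseudometric d →
                 ∀ z {x y} → d x y ≃ 0ℝ → d z y ≤ d z x
zeroDistance⇒≤ {d = d} isPseudometric z {x} {y} x∼y = begin
  d z y         ≤⟨ d-triangle z x y ⟩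
  d z x ⊕ d x y ≤⟨ ⊕-mono-≤ {d z x} {d z x} {d x y} {0ℝ}
                     (≤-refl {d z x}) (≃⇒≤ {d x y} {0ℝ} x∼y) ⟩
  d z x ⊕ 0ℝ    ≈⟨ ⊕-identityʳ (d z x) ⟩
  d z x         ∎
  where
  open IsPseudometric isPseudometric
  open ≤-Reasoning ≤-poset

proposition2p4 : ∀ {ℓ : Level} (M : Pred ℤ ℓ) (1∈M : 1ℤ ∈ M)
    (d : ⟪ M ⟫ → ⟪ M ⟫ → ℝ) (isPseudometric : IsPseudometric d) →
    zeroDistance isPseudometric ⊑ symmetricPart (inducedPreorder 1∈M d)
proposition2p4 M 1∈M d isPseudometric x {y} x∼y =
  -- The detour for `x ≲ y` passes through `y`, hence the reversed relation.
  zeroDistance⇒≤ isPseudometric one {y} {x} (∼-sym {x} {y} x∼y) ,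
  zeroDistance⇒≤ isPseudometric one {x} {y} x∼y
  where
  open IsEquivalence (Partition.isEquivalence (zeroDistance isPseudometric))
    using () renaming (sym to ∼-sym)

  -- The same element as the base point local to `inducedPreorder`, so both bounds match its order
  -- by definition.
  one : ⟪ M ⟫
  one = 1ℤ , [ 1∈M ]
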